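{- Let $R$ be a dedekind type domain having infinitely many maximal ideals, let $\mathit{M}(R)$ be the monoid generated by the maximal ideals of $R$, let $\mathcal{I}_1,\dots,\mathcal{I}_r\in\mathit{M}(R)$ be pairwise comaximal, and let $k\ge2$ with $r\le k$. Let $G_{r,k}(R)$ be the set of $r\times k$ matrices $A=[a_{ij}]$ over $R$ whose $r\times r$ minors generate the unit ideal. Then the map $\tau:G_{r,k}(R)\to\mathbb{PF}^{k-1}_{\mathcal{I}_1}\times\cdots\times\mathbb{PF}^{k-1}_{\mathcal{I}_r}$, $\tau(A)=([a_{11}:\dots:a_{1k}],\dots,[a_{r1}:\dots:a_{rk}])$, is surjective.
   Context: Dedekind type domain: a commutative ring $R$ with unity which is a field, or in which every maximal ideal $\mathcal{M}$ satisfies $\mathcal{M}^i\neq\mathcal{M}^{i+1}$ ($i\ge0$), $\bigcap_{i\ge0}\mathcal{M}^i=(0)$, $\dim_{R/\mathcal{M}}\mathcal{M}^i/\mathcal{M}^{i+1}=1$ ($i\ge0$), and every nonzero element lies in only finitely many maximal ideals. $\mathit{M}(R)$ is the set of finite products of maximal ideals ($R$ the empty product). For an ideal $\mathcal{I}$, $\mathbb{PF}^{n}_{\mathcal{I}}$ is the set of unital tuples $(a_0,\dots,a_n)$ (generating $R$) modulo $(a_i)\sim(b_i)\iff a_ib_j-a_jb_i\in\mathcal{I}$ for all $i<j$; $[a_0:\dots:a_n]$ denotes the class. -}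

module Defs where

open import Level using (Level; _⊔_; suc; Lift)
open import Algebra.Bundles using (CommutativeRing)
open import Data.Nat as ℕ using (ℕ; zero)
open import Data.Fin as Fin using (Fin; toℕ; punchIn)
open import Data.List using (List; []; _∷_)
open import Data.List.Relation.Unary.All using (All)
open import Data.List.Relation.Unary.Any using (Any)
open import Data.Product using (Σ; ∃; ∃-syntax; _×_; _,_)
open import Data.Sum using (_⊎_)
open import Data.Unit.Polymorphic using (⊤)
open import Relation.Nullary using (¬_)

module _ {c ℓ : Level} (R : CommutativeRing c ℓ) where
  open CommutativeRing R

  Subset : Set (Level.suc (c ⊔ ℓ))
  Subset = Carrier → Set (c ⊔ ℓ)

  _⊆_ : Subset → Subset → Set (c ⊔ ℓ)
  P ⊆ Q = ∀ x → P x → Q x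

  _≐_ : Subset → Subset → Set (c ⊔ ℓ)
  P ≐ Q = (P ⊆ Q) × (Q ⊆ P)

  record IsIdeal (I : Subset) : Set (c ⊔ ℓ) where
    field
      resp  : ∀ {x y} → x ≈ y → I x → I y
      zero∈ : I 0#
      +∈    : ∀ {x y} → I x → I y → I (x + y)
      *∈    : ∀ a {x} → I x → I (a * x)

  lincomb : List (Carrier × Carrier) → Carrier
  lincomb []             = 0#
  lincomb ((a , s) ∷ xs) = a * s + lincomb xs

  snd : Carrier × Carrier → Carrier
  snd (_ , s) = s

  ⟨_⟩ : Subset → Subset
  ⟨ S ⟩ x = ∃[ xs ] (All (λ p → S (snd p)) xs × x ≈ lincomb xs)

  _·_ : Subset → Subset → Subset
  (I · J) = ⟨ (λ y → ∃[ a ] ∃[ b ] (I a × J b × y ≈ a * b)) ⟩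

  whole : Subset
  whole _ = ⊤

  _^_ : Subset → ℕ → Subset
  I ^ zero      = whole
  I ^ ℕ.suc i   = I · (I ^ i)

  prodList : List Subset → Subset
  prodList []       = whole
  prodList (I ∷ Is) = I · prodList Is

  record IsMaximal (M : Subset) : Set (Level.suc (c ⊔ ℓ)) where
    field
      ideal   : IsIdeal M
      proper  : ¬ M 1#
      maximal : ∀ (J : Subset) → IsIdeal J → M ⊆ J → (J ⊆ M) ⊎ J 1#

  IsField : Set (c ⊔ ℓ)
  IsField = (¬ 1# ≈ 0#) × (∀ x → ¬ x ≈ 0# → ∃[ y ] (x * y ≈ 1#))

  -- dim_{R/M} M^i / M^{i+1} = 1 : there is a one-element basis {ē} of the
  -- R/M-vector space M^i/M^{i+1} (ē ≠ 0, ē spans, ē linearly independent)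
  DimOne : Subset → ℕ → Set (c ⊔ ℓ)
  DimOne M i =
    ∃[ e ] ( (M ^ i) e
           × ¬ (M ^ ℕ.suc i) e
           × (∀ x → (M ^ i) x → ∃[ a ] ((M ^ ℕ.suc i) (x + - (a * e))))
           × (∀ a → (M ^ ℕ.suc i) (a * e) → M a))

  GoodMaximal : Subset → Set (c ⊔ ℓ)
  GoodMaximal M =
      (∀ i → ¬ ((M ^ i) ≐ (M ^ ℕ.suc i)))
    × (∀ x → (∀ i → (M ^ i) x) → x ≈ 0#)
    × (∀ i → DimOne M i)

  FinitelyManyMaxContaining : Set (Level.suc (c ⊔ ℓ))
  FinitelyManyMaxContaining =
    ∀ x → ¬ x ≈ 0# →
      ∃[ Ms ] (∀ (M : Subset) → IsMaximal M → M x → Any (λ N → M ≐ N) Ms)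

  DedekindType : Set (Level.suc (c ⊔ ℓ))
  DedekindType =
    IsField ⊎ ((∀ M → IsMaximal M → GoodMaximal M) × FinitelyManyMaxContaining)

  InfinitelyManyMaximal : Set (Level.suc (c ⊔ ℓ))
  InfinitelyManyMaximal =
    ∀ (Ms : List Subset) → ∃[ M ] (IsMaximal M × All (λ N → ¬ (M ≐ N)) Ms)

  InM : Subset → Set (Level.suc (c ⊔ ℓ))
  InM I = ∃[ Ms ] (All IsMaximal Ms × (I ≐ prodList Ms))

  Comaximal : Subset → Subset → Set (c ⊔ ℓ)
  Comaximal I J = ∃[ a ] ∃[ b ] (I a × J b × a + b ≈ 1#)

  Unital : ∀ {n} → (Fin n → Carrier) → Set (c ⊔ ℓ)
  Unital a = ⟨ (λ y → Lift c (∃[ i ] (y ≈ a i))) ⟩ 1#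

  PFRel : Subset → ∀ {n} → (Fin n → Carrier) → (Fin n → Carrier) → Set (c ⊔ ℓ)
  PFRel I a b = ∀ i j → i Fin.< j → I (a i * b j + - (a j * b i))

  sumFin : ∀ n → (Fin n → Carrier) → Carrier
  sumFin zero      f = 0#
  sumFin (ℕ.suc n) f = f Fin.zero + sumFin n (λ i → f (Fin.suc i))

  sgn : ℕ → Carrier
  sgn zero      = 1#
  sgn (ℕ.suc n) = - sgn n

  det : ∀ n → (Fin n → Fin n → Carrier) → Carrier
  det zero      A = 1#
  det (ℕ.suc n) A =
    sumFin (ℕ.suc n) (λ j → sgn (toℕ j) * (A Fin.zero j *
      det n (λ i l → A (Fin.suc i) (punchIn j l))))

  StrictlyIncreasing : ∀ {r k} → (Fin r → Fin k) → Set
  StrictlyIncreasing σ = ∀ i j → i Fin.< j → σ i Fin.< σ j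

  InG : ∀ {r k} → (Fin r → Fin k → Carrier) → Set (c ⊔ ℓ)
  InG {r} A =
    ⟨ (λ y → Lift c (∃[ σ ] (StrictlyIncreasing σ × y ≈ det r (λ i j → A i (σ j))))) ⟩ 1#

-- Column operations between adjacent columns preserve the ideal of maximal minors.
-- Modulo a product of maximal ideals R is semilocal, so it has stable range one and
-- such operations carry a unital row v to a multiple u e_l of the l-th unit row.
-- Their inverses, with coefficients multiplied by ε_l ≡ 1 mod I_l that vanishes
-- modulo the other ideals, can be performed for all l in succession on the unit
-- rows without disturbing each other; then u A_l ≡ v_l mod I_l, which already
-- forces the 2 × 2 minors of (A_l, v_l) into I_l.

module Submission where

open import Defs
open import Level using (Level; _⊔_; Lift; lift)
open import Algebra.Bundles using (CommutativeRing; RawRing)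
open import Algebra.Solver.Ring.AlmostCommutativeRing using (fromCommutativeRing; _-Raw-AlmostCommutative⟶_)
open import Data.Nat as ℕ using (ℕ; zero; suc; _≤_)
import Data.Nat.Properties as ℕₚ
open import Data.Fin as Fin using (Fin; zero; suc; toℕ; inject₁; inject≤; punchIn; punchOut; fromℕ<)
import Data.Fin.Properties as Finₚ
open import Data.List using (List; []; _∷_; _++_; map)
open import Data.List.Relation.Unary.All as All using (All; []; _∷_)
import Data.List.Relation.Unary.All.Properties as Allₚ
open import Data.List.Relation.Unary.Any using (Any; here; there)
open import Data.Maybe using (Maybe; just; nothing)
open import Data.Product using (∃-syntax; _×_; _,_; proj₁; proj₂)
open import Data.Sum as Sum using (_⊎_; inj₁; inj₂)
open import Data.Unit.Polymorphic using (tt)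
open import Data.Vec.Functional as Vector using (updateAt)
import Data.Vec.Functional.Properties as Vectorₚ
open import Function using (_∘_; const)
open import Relation.Binary.Definitions using (tri<; tri≈; tri>)
open import Relation.Binary.PropositionalEquality as ≡ using (_≡_; _≢_)
open import Relation.Nullary using (¬_; yes; no; contradiction)

-- A column operation acts on all rows at once, while each row must be corrected modulo its own
-- ideal. Lifting the rows one by one would give no control over the maximal minors; here the matrix
-- starts inside `InG` and every step keeps it there. The starting rows are `e_l`, not `u_l e_l`.
-- With rows `u_l e_l` the only minor not forced to vanish would be the product of the `u_l`, and
-- nothing makes that product a unit of `R`. The scalar is instead left over at the end, where the
-- projective class absorbs it. Adjacent operations suffice for the reduction: the information of a
-- row is passed from its last entry to its first, one column at a time, and then sent back to the
-- column wanted. The maximal factors of an ideal may repeat. Invertibility modulo each factor still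
-- gives invertibility modulo the product, so prime powers need no separate treatment.

module CommutativeRingSolver {c ℓ : Level} (R : CommutativeRing c ℓ) where
  open CommutativeRing R hiding (zero)
  open import Algebra.Properties.Ring ring using (-‿distribˡ-*; -‿distribʳ-*; -‿involutive; -0#≈0#)
  open import Algebra.Properties.AbelianGroup +-abelianGroup using (⁻¹-∙-comm)
  open import Algebra.Properties.Semiring.Mult semiring using (×-homo-+; ×1-homo-*) renaming (_×_ to _×ℕ_)
  open import Algebra.Properties.CommutativeSemigroup +-commutativeSemigroup using (interchange)
  open import Relation.Binary.Reasoning.Setoid setoid

  -- The integer coefficients are formal differences m − n of naturals: no
  -- normalisation is needed for the homomorphism laws.
  Difference : RawRing _ _
  Difference = record
    { Carrier = ℕ × ℕ
    ; _≈_ = _≡_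
    ; _+_ = λ (a , b) (c , d) → a ℕ.+ c , b ℕ.+ d
    ; _*_ = λ (a , b) (c , d) → a ℕ.* c ℕ.+ b ℕ.* d , a ℕ.* d ℕ.+ b ℕ.* c
    ; -_  = λ (a , b) → b , a
    ; 0#  = 0 , 0
    ; 1#  = 1 , 0
    }

  private
    module Δ = RawRing Difference

    ν : ℕ → Carrier
    ν n = n ×ℕ 1#

    val : ℕ × ℕ → Carrier
    val (m , n) = ν m + - ν n

    -- Agrees with val, but sends the constants 0 and 1 to 0# and 1# on the nose,
    -- so that they can be used in goals.
    ⟦_⟧ : ℕ × ℕ → Carrier
    ⟦ 0 , 0 ⟧ = 0#
    ⟦ 1 , 0 ⟧ = 1#
    ⟦ m , n ⟧ = ν m + - ν n

    val0 : val (0 , 0) ≈ 0#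
    val0 = -‿inverseʳ 0#

    val1 : val (1 , 0) ≈ 1#
    val1 = begin
      (1# + 0#) + - 0#  ≈⟨ +-cong (+-identityʳ 1#) -0#≈0# ⟩
      1# + 0#           ≈⟨ +-identityʳ 1# ⟩
      1#                ∎

    ⟦⟧≈val : ∀ p → ⟦ p ⟧ ≈ val p
    ⟦⟧≈val (0 , 0) = sym val0
    ⟦⟧≈val (1 , 0) = sym val1
    ⟦⟧≈val (0 , suc _) = refl
    ⟦⟧≈val (1 , suc _) = refl
    ⟦⟧≈val (suc (suc _) , 0) = refl
    ⟦⟧≈val (suc (suc _) , suc _) = refl

    difference-+ : ∀ a b c d → (a + c) + - (b + d) ≈ (a + - b) + (c + - d)
    difference-+ a b c d = trans (+-congˡ (sym (⁻¹-∙-comm b d))) (interchange a c (- b) (- d))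

    val-+ : ∀ p q → val (p Δ.+ q) ≈ val p + val q
    val-+ (a , b) (c , d) = trans
      (+-cong (×-homo-+ 1# a c) (-‿cong (×-homo-+ 1# b d)))
      (difference-+ (ν a) (ν b) (ν c) (ν d))

    difference-* : ∀ a b c d →
      (a * c + b * d) + - (a * d + b * c) ≈ (a + - b) * (c + - d)
    difference-* a b c d = sym (begin
      (a + - b) * (c + - d)
        ≈⟨ trans (distribˡ _ c (- d)) (+-cong (distribʳ c a (- b)) (distribʳ (- d) a (- b))) ⟩
      (a * c + - b * c) + (a * - d + - b * - d)
        ≈⟨ +-cong (+-congˡ (sym (-‿distribˡ-* b c)))
                  (+-cong (sym (-‿distribʳ-* a d))
                          (trans (sym (-‿distribˡ-* b (- d)))
                          (trans (-‿cong (sym (-‿distribʳ-* b d))) (-‿involutive _)))) ⟩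
      (a * c + - (b * c)) + (- (a * d) + b * d)
        ≈⟨ +-congˡ (+-comm _ _) ⟩
      (a * c + - (b * c)) + (b * d + - (a * d))
        ≈⟨ difference-+ _ _ _ _ ⟨
      (a * c + b * d) + - (b * c + a * d)
        ≈⟨ +-congˡ (-‿cong (+-comm _ _)) ⟩
      (a * c + b * d) + - (a * d + b * c) ∎)

    val-* : ∀ p q → val (p Δ.* q) ≈ val p * val q
    val-* (a , b) (c , d) = trans
      (+-cong (ν-+* a c b d) (-‿cong (ν-+* a d b c)))
      (difference-* (ν a) (ν b) (ν c) (ν d))
      where
      ν-+* : ∀ m n o p → ν (m ℕ.* n ℕ.+ o ℕ.* p) ≈ ν m * ν n + ν o * ν p
      ν-+* m n o p = trans (×-homo-+ 1# (m ℕ.* n) (o ℕ.* p)) (+-cong (×1-homo-* m n) (×1-homo-* o p))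

    val-neg : ∀ p → val (Δ.- p) ≈ - val p
    val-neg (a , b) = begin
      ν b + - ν a      ≈⟨ +-comm _ _ ⟩
      - ν a + ν b      ≈⟨ +-congˡ (-‿involutive _) ⟨
      - ν a + - - ν b  ≈⟨ ⁻¹-∙-comm _ _ ⟩
      - (ν a + - ν b)  ∎

    morphism : Difference -Raw-AlmostCommutative⟶ fromCommutativeRing R
    morphism = record
      { ⟦_⟧    = ⟦_⟧
      ; +-homo = λ p q → trans (⟦⟧≈val (p Δ.+ q)) (trans (val-+ p q) (sym (+-cong (⟦⟧≈val p) (⟦⟧≈val q))))
      ; *-homo = λ p q → trans (⟦⟧≈val (p Δ.* q)) (trans (val-* p q) (sym (*-cong (⟦⟧≈val p) (⟦⟧≈val q))))
      ; -‿homo = λ p → trans (⟦⟧≈val (Δ.- p)) (trans (val-neg p) (-‿cong (sym (⟦⟧≈val p))))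
      ; 0-homo = refl
      ; 1-homo = refl
      }

    val-≈ : ∀ a b c d → a ℕ.+ d ≡ c ℕ.+ b → val (a , b) ≈ val (c , d)
    val-≈ a b c d eq = begin
      ν a + - ν b                      ≈⟨ +-identityʳ _ ⟨
      (ν a + - ν b) + 0#               ≈⟨ +-congˡ (-‿inverseʳ (ν d)) ⟨
      (ν a + - ν b) + (ν d + - ν d)    ≈⟨ difference-+ _ _ _ _ ⟨
      (ν a + ν d) + - (ν b + ν d)      ≈⟨ +-congʳ (×-homo-+ 1# a d) ⟨
      ν (a ℕ.+ d) + - (ν b + ν d)      ≡⟨ ≡.cong (λ n → ν n + - (ν b + ν d)) eq ⟩
      ν (c ℕ.+ b) + - (ν b + ν d)      ≈⟨ +-cong (×-homo-+ 1# c b) (-‿cong (+-comm _ _)) ⟩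
      (ν c + ν b) + - (ν d + ν b)      ≈⟨ difference-+ _ _ _ _ ⟩
      (ν c + - ν d) + (ν b + - ν b)    ≈⟨ +-congˡ (-‿inverseʳ (ν b)) ⟩
      (ν c + - ν d) + 0#               ≈⟨ +-identityʳ _ ⟩
      ν c + - ν d                      ∎

    -- Differences have many representatives, so coefficients are compared by cross sums. The answer
    -- `nothing` claims no inequality: distinct integers may agree in a ring of positive
    -- characteristic.
    _≟Δ_ : ∀ p q → Maybe (⟦ p ⟧ ≈ ⟦ q ⟧)
    (a , b) ≟Δ (c , d) with a ℕ.+ d ℕ.≟ c ℕ.+ b
    ... | yes eq = just (trans (⟦⟧≈val (a , b)) (trans (val-≈ a b c d eq) (sym (⟦⟧≈val (c , d)))))
    ... | no _   = nothing

  open import Algebra.Solver.Ring Difference (fromCommutativeRing R) morphism _≟Δ_ public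
    using (Polynomial; solve; _:=_; _:+_; _:*_; _:-_; :-_; con)

  :0 :1 : ∀ {n} → Polynomial n
  :0 = con (0 , 0)
  :1 = con (1 , 0)

-- Maximal ideals, stable range and Chinese remainder elements.

module Ideals {c ℓ : Level} (R : CommutativeRing c ℓ) where
  open CommutativeRing R hiding (zero)
  open CommutativeRingSolver R
  open import Algebra.Properties.Ring ring using (-1*x≈-x)
  open IsIdeal

  neg∈ : ∀ {I} → IsIdeal R I → ∀ {x} → I x → I (- x)
  neg∈ idI {x} x∈ = resp idI (-1*x≈-x x) (*∈ idI (- 1#) x∈)

  lincomb-++ : ∀ xs ys → lincomb R (xs ++ ys) ≈ lincomb R xs + lincomb R ys
  lincomb-++ [] ys = sym (+-identityˡ _)
  lincomb-++ (_ ∷ xs) ys = trans (+-congˡ (lincomb-++ xs ys)) (sym (+-assoc _ _ _))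

  scaleCoefficients : Carrier → List (Carrier × Carrier) → List (Carrier × Carrier)
  scaleCoefficients a = map (λ (b , s) → a * b , s)

  lincomb-scale : ∀ a xs → lincomb R (scaleCoefficients a xs) ≈ a * lincomb R xs
  lincomb-scale a [] = sym (zeroʳ a)
  lincomb-scale a ((b , s) ∷ xs) =
    trans (+-cong (*-assoc a b s) (lincomb-scale a xs)) (sym (distribˡ a _ _))

  span-ideal : ∀ S → IsIdeal R (⟨_⟩ R S)
  span-ideal S = record
    { resp  = λ x≈y (xs , ss , eq) → xs , ss , trans (sym x≈y) eq
    ; zero∈ = [] , [] , refl
    ; +∈    = λ (xs , ss , eq) (ys , ts , eq′) →
        xs ++ ys , Allₚ.++⁺ ss ts , trans (+-cong eq eq′) (sym (lincomb-++ xs ys))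
    ; *∈    = λ a (xs , ss , eq) →
        scaleCoefficients a xs , Allₚ.map⁺ ss , trans (*-congˡ eq) (sym (lincomb-scale a xs))
    }

  span-generator : ∀ {S : Subset R} {x} → S x → ⟨_⟩ R S x
  span-generator {x = x} s = (1# , x) ∷ [] , s ∷ [] , solve 1 (λ x → x := :1 :* x :+ :0) refl x

  span-least : ∀ {S I} → IsIdeal R I → _⊆_ R S I → _⊆_ R (⟨_⟩ R S) I
  span-least {S} {I} idI S⊆I x (xs , ss , eq) = resp idI (sym eq) (go xs ss)
    where
    go : ∀ xs → All (S ∘ snd R) xs → I (lincomb R xs)
    go [] [] = zero∈ idI
    go ((a , s) ∷ xs) (s∈ ∷ ss) = +∈ idI (*∈ idI a (S⊆I s s∈)) (go xs ss)

  ·-intro : ∀ {I J : Subset R} {a b} → I a → J b → _·_ R I J (a * b)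
  ·-intro a∈ b∈ = span-generator (_ , _ , a∈ , b∈ , refl)

  whole-ideal : IsIdeal R (whole R)
  whole-ideal = record { resp = λ _ _ → tt ; zero∈ = tt ; +∈ = λ _ _ → tt ; *∈ = λ _ _ → tt }

  prodList-ideal : ∀ Is → IsIdeal R (prodList R Is)
  prodList-ideal [] = whole-ideal
  prodList-ideal (I ∷ Is) = span-ideal _

  ideal-resp-≐ : ∀ {I J} → _≐_ R I J → IsIdeal R J → IsIdeal R I
  ideal-resp-≐ (I⊆J , J⊆I) idJ = record
    { resp  = λ x≈y x∈ → J⊆I _ (resp idJ x≈y (I⊆J _ x∈))
    ; zero∈ = J⊆I _ (zero∈ idJ)
    ; +∈    = λ x∈ y∈ → J⊆I _ (+∈ idJ (I⊆J _ x∈) (I⊆J _ y∈))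
    ; *∈    = λ a x∈ → J⊆I _ (*∈ idJ a (I⊆J _ x∈))
    }

  _⊹_ : Subset R → Subset R → Subset R
  (I ⊹ J) x = ∃[ a ] ∃[ b ] (I a × J b × x ≈ a + b)

  ⊹-ideal : ∀ {I J} → IsIdeal R I → IsIdeal R J → IsIdeal R (I ⊹ J)
  ⊹-ideal idI idJ = record
    { resp  = λ x≈y (a , b , a∈ , b∈ , eq) → a , b , a∈ , b∈ , trans (sym x≈y) eq
    ; zero∈ = 0# , 0# , zero∈ idI , zero∈ idJ , sym (+-identityˡ 0#)
    ; +∈    = λ (a , b , a∈ , b∈ , eq) (a′ , b′ , a′∈ , b′∈ , eq′) →
        a + a′ , b + b′ , +∈ idI a∈ a′∈ , +∈ idJ b∈ b′∈ ,
        trans (+-cong eq eq′)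
          (solve 4 (λ a b a′ b′ → (a :+ b) :+ (a′ :+ b′) := (a :+ a′) :+ (b :+ b′)) refl a b a′ b′)
    ; *∈    = λ r (a , b , a∈ , b∈ , eq) →
        r * a , r * b , *∈ idI r a∈ , *∈ idJ r b∈ , trans (*-congˡ eq) (distribˡ r a b)
    }

  ⊹-inˡ : ∀ {I J} → IsIdeal R J → _⊆_ R I (I ⊹ J)
  ⊹-inˡ idJ x x∈ = x , 0# , x∈ , zero∈ idJ , sym (+-identityʳ x)

  ⊹-inʳ : ∀ {I J} → IsIdeal R I → _⊆_ R J (I ⊹ J)
  ⊹-inʳ idI x x∈ = 0# , x , zero∈ idI , x∈ , sym (+-identityˡ x)

  principal : Carrier → Subset R
  principal x y = Lift c (∃[ r ] (y ≈ r * x))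

  principal-ideal : ∀ x → IsIdeal R (principal x)
  principal-ideal x = record
    { resp  = λ y≈z (lift (r , eq)) → lift (r , trans (sym y≈z) eq)
    ; zero∈ = lift (0# , sym (zeroˡ x))
    ; +∈    = λ (lift (r , eq)) (lift (s , eq′)) → lift (r + s , trans (+-cong eq eq′) (sym (distribʳ x r s)))
    ; *∈    = λ a (lift (r , eq)) → lift (a * r , trans (*-congˡ eq) (sym (*-assoc a r x)))
    }

  InvertibleMod : Subset R → Carrier → Set (c ⊔ ℓ)
  InvertibleMod I x = ∃[ y ] I (1# + - (x * y))

  -- The disjunction in IsMaximal makes membership in a maximal ideal decidable.
  maximal-dec : ∀ {M} → IsMaximal R M → ∀ x → M x ⊎ InvertibleMod M x
  maximal-dec {M} maxM x with maximal (M ⊹ principal x) (⊹-ideal ideal (principal-ideal x)) (⊹-inˡ (principal-ideal x))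
    where open IsMaximal maxM
  ... | inj₁ ⊆M = inj₁ (⊆M x (⊹-inʳ (IsMaximal.ideal maxM) x (lift (1# , sym (*-identityˡ x)))))
  ... | inj₂ (m , _ , m∈ , lift (y , eq′) , eq) = inj₂ (y , resp (IsMaximal.ideal maxM) m≈ m∈)
    where
    open import Relation.Binary.Reasoning.Setoid setoid
    m≈ : m ≈ 1# + - (x * y)
    m≈ = begin
      m                    ≈⟨ solve 3 (λ m y x → m := (m :+ y :* x) :- x :* y) refl m y x ⟩
      (m + y * x) + - (x * y) ≈⟨ +-congʳ (trans eq (+-congˡ eq′)) ⟨
      1# + - (x * y)       ∎

  invertible-cancel : ∀ {M} → IsIdeal R M → ∀ {s} → InvertibleMod M s → ∀ {b} → M (s * b) → M b
  invertible-cancel idM {s} (y , inv) {b} sb∈ =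
    resp idM (solve 3 (λ s y b → y :* (s :* b) :+ b :* (:1 :- s :* y) := b) refl s y b)
      (+∈ idM (*∈ idM y sb∈) (*∈ idM b inv))

  maximal-prime : ∀ {M} → IsMaximal R M → ∀ {s b} → ¬ M s → M (s * b) → M b
  maximal-prime maxM {s} s∉ sb∈ with maximal-dec maxM s
  ... | inj₁ s∈  = contradiction s∈ s∉
  ... | inj₂ inv = invertible-cancel (IsMaximal.ideal maxM) inv sb∈

  -- Distinct maximal ideals are comaximal, so each `N` supplies a factor `n` that lies in `N` and
  -- is 1 modulo `M`; `s` is the product of these factors. Maximality of `N`, applied to `N ⊹ M`,
  -- decides between the two alternatives.
  separate : ∀ {M Ms} → IsMaximal R M → All (IsMaximal R) Ms →
    Any (_≐_ R M) Ms ⊎ ∃[ s ] (¬ M s × All (λ N → N s) Ms)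
  separate maxM [] = inj₂ (1# , IsMaximal.proper maxM , [])
  separate {M} {N ∷ Ms} maxM (maxN ∷ maxMs)
    with IsMaximal.maximal maxN (N ⊹ M) (⊹-ideal (IsMaximal.ideal maxN) (IsMaximal.ideal maxM)) (⊹-inˡ (IsMaximal.ideal maxM))
  ... | inj₁ ⊆N = inj₁ (here (M⊆N , N⊆M))
    where
    M⊆N : _⊆_ R M N
    M⊆N x x∈ = ⊆N x (⊹-inʳ (IsMaximal.ideal maxN) x x∈)
    N⊆M : _⊆_ R N M
    N⊆M with IsMaximal.maximal maxM N (IsMaximal.ideal maxN) M⊆N
    ... | inj₁ sub = sub
    ... | inj₂ 1∈N = contradiction 1∈N (IsMaximal.proper maxN)
  ... | inj₂ (n , m , n∈ , m∈ , 1≈n+m) with separate maxM maxMs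
  ...   | inj₁ any = inj₁ (there any)
  ...   | inj₂ (s , s∉ , s∈) = inj₂ (s * n , sn∉ , *∈ idN s n∈ ∷ All.zipWith times (maxMs , s∈))
    where
    idN = IsMaximal.ideal maxN
    idM = IsMaximal.ideal maxM
    sn∉ : ¬ M (s * n)
    sn∉ sn∈ = s∉ (resp idM
      (trans (sym (distribˡ s n m)) (trans (*-congˡ (sym 1≈n+m)) (*-identityʳ s)))
      (+∈ idM sn∈ (*∈ idM s m∈)))
    times : ∀ {J} → IsMaximal R J × J s → J (s * n)
    times (maxJ , s∈J) = resp (IsMaximal.ideal maxJ) (*-comm n s) (*∈ (IsMaximal.ideal maxJ) n s∈J)

  -- One `t` serves all listed ideals, and `a`, `b` are not asked to generate the unit ideal. The
  -- implication form lets the result be iterated along a row before unitality is invoked. A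
  -- repeated ideal is covered by its earlier treatment.
  stable-range : ∀ {Ms} → All (IsMaximal R) Ms → ∀ a b →
    ∃[ t ] All (λ M → M (a + t * b) → M a × M b) Ms
  stable-range [] a b = 0# , []
  stable-range {M ∷ Ms} (maxM ∷ maxMs) a b with stable-range maxMs a b
  ... | t , good with separate maxM maxMs | maximal-dec maxM (a + t * b)
  ...   | inj₁ M∈Ms | _ = t , transfer M∈Ms good ∷ good
    where
    transfer : ∀ {Ns} → Any (_≐_ R M) Ns → All (λ N → N (a + t * b) → N a × N b) Ns →
      M (a + t * b) → M a × M b
    transfer (here (M⊆N , N⊆M)) (g ∷ _) x∈ with g (M⊆N _ x∈)
    ... | a∈ , b∈ = N⊆M _ a∈ , N⊆M _ b∈
    transfer (there any) (_ ∷ gs) = transfer any gs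
  ...   | inj₂ _ | inj₂ (y , inv) = t , (λ x∈ → contradiction (1∈M x∈) (IsMaximal.proper maxM)) ∷ good
    where
    idM = IsMaximal.ideal maxM
    1∈M : M (a + t * b) → M 1#
    1∈M x∈ = invertible-cancel idM (y , inv) (resp idM (sym (*-identityʳ _)) x∈)
  -- Adding `s` to `t` changes nothing modulo the ideals already treated. Modulo `M` it changes a
  -- vanishing value by `s * b`, which vanishes only if `b` does, and then `a` does too.
  ...   | inj₂ (s , s∉ , s∈) | inj₁ a+tb∈ = t + s , newM ∷ All.zipWith old (maxMs , All.zip (s∈ , good))
    where
    split : a + (t + s) * b ≈ (a + t * b) + s * b
    split = solve 4 (λ a t s b → a :+ (t :+ s) :* b := (a :+ t :* b) :+ s :* b) refl a t s b
    newM : M (a + (t + s) * b) → M a × M b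
    newM x∈ = a∈ , b∈
      where
      idM = IsMaximal.ideal maxM
      b∈ : M b
      b∈ = maximal-prime maxM s∉ (resp idM
        (trans (+-congʳ split) (solve 2 (λ x y → (x :+ y) :- x := y) refl (a + t * b) (s * b)))
        (+∈ idM x∈ (neg∈ idM a+tb∈)))
      a∈ : M a
      a∈ = resp idM (solve 3 (λ a t b → (a :+ t :* b) :- t :* b := a) refl a t b)
        (+∈ idM a+tb∈ (neg∈ idM (*∈ idM t b∈)))
    old : ∀ {N} → IsMaximal R N × N s × (N (a + t * b) → N a × N b) → N (a + (t + s) * b) → N a × N b
    old (maxN , s∈N , g) x∈ = g (resp idN
      (trans (+-congʳ split) (solve 3 (λ x s b → (x :+ s :* b) :- b :* s := x) refl (a + t * b) s b))
      (+∈ idN x∈ (neg∈ idN (*∈ idN b s∈N))))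
      where idN = IsMaximal.ideal maxN

  -- The new inverse is read off from multiplying out `(1 - u y)(1 - u y′)`. No comaximality enters,
  -- so repeated factors are harmless.
  invertible-prodList : ∀ {u} Ms → All (λ M → InvertibleMod M u) Ms → InvertibleMod (prodList R Ms) u
  invertible-prodList [] [] = 0# , tt
  invertible-prodList {u} (M ∷ Ms) ((y , inv) ∷ invs) with invertible-prodList Ms invs
  ... | y′ , inv′ = y + y′ + - (u * y * y′) , resp (span-ideal _)
    (solve 3 (λ u y y′ → (:1 :- u :* y) :* (:1 :- u :* y′) := :1 :- u :* (y :+ y′ :- u :* y :* y′)) refl u y y′)
    (·-intro {M} inv inv′)

  -- From `a + b ≈ 1` the element `b` is 1 modulo `I` and lies in `J x`; `ε` is the product of such
  -- elements. `Q` marks the indices to skip, so that `I` may itself be a member of the family and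
  -- no index has to be removed from `Fin m`.
  crt-idempotent : ∀ {I} → IsIdeal R I → ∀ {m} (J : Fin m → Subset R) → (∀ x → IsIdeal R (J x)) →
    (Q : Fin m → Set) → (∀ x → Q x ⊎ Comaximal R I (J x)) →
    ∃[ ε ] (I (ε + - 1#) × (∀ x → Q x ⊎ J x ε))
  crt-idempotent idI {zero} J idJ Q com = 1# , resp idI (sym (-‿inverseʳ 1#)) (zero∈ idI) , λ ()
  crt-idempotent {I} idI {suc m} J idJ Q com
    with crt-idempotent idI (J ∘ suc) (idJ ∘ suc) (Q ∘ suc) (com ∘ suc) | com zero
  ... | ε , ε≡1 , ε∈ | inj₁ q = ε , ε≡1 , λ { zero → inj₁ q ; (suc x) → ε∈ x }
  ... | ε , ε≡1 , ε∈ | inj₂ (a , b , a∈ , b∈ , a+b≈1) = b * ε , bε≡1 , vanish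
    where
    bε≡1 : I (b * ε + - 1#)
    bε≡1 = resp idI
      (trans (solve 3 (λ a b ε → b :* (ε :- :1) :+ (:- :1) :* a := b :* ε :- (a :+ b)) refl a b ε)
             (+-congˡ (-‿cong a+b≈1)))
      (+∈ idI (*∈ idI b ε≡1) (*∈ idI (- 1#) a∈))
    vanish : ∀ x → Q x ⊎ J x (b * ε)
    vanish zero = inj₂ (resp (idJ zero) (*-comm ε b) (*∈ (idJ zero) ε b∈))
    vanish (suc x) with ε∈ x
    ... | inj₁ q = inj₁ q
    ... | inj₂ e = inj₂ (*∈ (idJ (suc x)) b e)

-- Determinants and the ideal of maximal minors.

module Minors {c ℓ : Level} (R : CommutativeRing c ℓ) where
  open CommutativeRing R hiding (zero)
  open CommutativeRingSolver R
  open Ideals R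
  open import Relation.Binary.Reasoning.Setoid setoid
  open IsIdeal

  Adjacent : ∀ {n} → Fin n → Fin n → Set
  Adjacent p q = (toℕ q ≡ suc (toℕ p)) ⊎ (toℕ p ≡ suc (toℕ q))

  adjacent-≢ : ∀ {n} {p q : Fin n} → Adjacent p q → q ≢ p
  adjacent-≢ (inj₁ eq) ≡.refl = ℕₚ.1+n≢n (≡.sym eq)
  adjacent-≢ (inj₂ eq) ≡.refl = ℕₚ.1+n≢n (≡.sym eq)

  adjacent-< : ∀ {n} {p q z : Fin n} → Adjacent p q → z ≢ q → p Fin.< z → q Fin.< z
  adjacent-< (inj₁ eq) z≢q p<z = ℕₚ.≤∧≢⇒< (≡.subst (_≤ _) (≡.sym eq) p<z) (λ e → z≢q (≡.sym (Finₚ.toℕ-injective e)))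
  adjacent-< (inj₂ eq) z≢q p<z = ℕₚ.<-trans (≡.subst (_ ℕ.<_) (≡.sym eq) ℕₚ.≤-refl) p<z

  adjacent-> : ∀ {n} {p q z : Fin n} → Adjacent p q → z ≢ q → z Fin.< p → z Fin.< q
  adjacent-> (inj₁ eq) z≢q z<p = ℕₚ.<-trans z<p (≡.subst (_ ℕ.<_) (≡.sym eq) ℕₚ.≤-refl)
  adjacent-> (inj₂ eq) z≢q z<p = ℕₚ.≤∧≢⇒< (ℕ.s≤s⁻¹ (≡.subst (_ ℕ.<_) eq z<p)) (λ e → z≢q (Finₚ.toℕ-injective e))

  sum-cong : ∀ n {f g : Fin n → Carrier} → (∀ j → f j ≈ g j) → sumFin R n f ≈ sumFin R n g
  sum-cong zero eq = refl
  sum-cong (suc n) eq = +-cong (eq zero) (sum-cong n (eq ∘ suc))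

  sum-zero : ∀ n {f : Fin n → Carrier} → (∀ j → f j ≈ 0#) → sumFin R n f ≈ 0#
  sum-zero zero eq = refl
  sum-zero (suc n) eq = trans (+-cong (eq zero) (sum-zero n (eq ∘ suc))) (+-identityˡ 0#)

  sum-linear : ∀ n {f g h : Fin n → Carrier} c → (∀ j → f j ≈ g j + c * h j) →
    sumFin R n f ≈ sumFin R n g + c * sumFin R n h
  sum-linear zero c eq = solve 1 (λ c → :0 := :0 :+ c :* :0) refl c
  sum-linear (suc n) c eq = trans (+-cong (eq zero) (sum-linear n c (eq ∘ suc)))
    (solve 5 (λ g h c G H → (g :+ c :* h) :+ (G :+ c :* H) := (g :+ G) :+ c :* (h :+ H)) refl _ _ _ _ _)

  sum-adjacent-cancel : ∀ n (i : Fin n) (f : Fin (suc n) → Carrier) →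
    f (inject₁ i) + f (suc i) ≈ 0# → (∀ j → j ≢ inject₁ i → j ≢ suc i → f j ≈ 0#) →
    sumFin R (suc n) f ≈ 0#
  sum-adjacent-cancel (suc n) zero f cancel vanish = begin
    f zero + (f (suc zero) + sumFin R n (λ j → f (suc (suc j))))
      ≈⟨ +-congˡ (+-congˡ (sum-zero n (λ j → vanish (suc (suc j)) (λ ()) (λ ())))) ⟩
    f zero + (f (suc zero) + 0#)  ≈⟨ +-congˡ (+-identityʳ _) ⟩
    f zero + f (suc zero)         ≈⟨ cancel ⟩
    0#                            ∎
  sum-adjacent-cancel (suc n) (suc i) f cancel vanish =
    trans (+-cong (vanish zero (λ ()) (λ ()))
                  (sum-adjacent-cancel n i (f ∘ suc) cancel
                    (λ j j≢ j≢′ → vanish (suc j) (j≢ ∘ Finₚ.suc-injective) (j≢′ ∘ Finₚ.suc-injective))))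
          (+-identityˡ 0#)

  Matrix : ℕ → ℕ → Set c
  Matrix r k = Fin r → Fin k → Carrier

  det-cong : ∀ n {A B : Matrix n n} → (∀ i j → A i j ≈ B i j) → det R n A ≈ det R n B
  det-cong zero eq = refl
  det-cong (suc n) eq = sum-cong (suc n) (λ j →
    *-congˡ {x = sgn R (toℕ j)} (*-cong (eq zero j) (det-cong n (λ i l → eq (suc i) (punchIn j l)))))

  -- The expansion runs along a row, the linearity is in a column. In the term `j = p` the entry
  -- splits and the minor omits column `p`; in every other term the entry is shared and the minor
  -- splits by induction.
  det-linear : ∀ n (p : Fin n) (A A′ B : Matrix n n) c →
    (∀ i x → x ≢ p → B i x ≈ A i x) → (∀ i x → x ≢ p → B i x ≈ A′ i x) →
    (∀ i → B i p ≈ A i p + c * A′ i p) →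
    det R n B ≈ det R n A + c * det R n A′
  det-linear (suc n) p A A′ B c offA offA′ atp = sum-linear (suc n) c term
    where
    minor : Matrix (suc n) (suc n) → Fin (suc n) → Carrier
    minor X j = det R n (λ i l → X (suc i) (punchIn j l))
    term : ∀ j → sgn R (toℕ j) * (B zero j * minor B j) ≈
      sgn R (toℕ j) * (A zero j * minor A j) + c * (sgn R (toℕ j) * (A′ zero j * minor A′ j))
    term j with j Finₚ.≟ p
    ... | yes ≡.refl = begin
      sgn R (toℕ j) * (B zero j * minor B j)
        ≈⟨ *-congˡ (*-congʳ (atp zero)) ⟩
      sgn R (toℕ j) * ((A zero j + c * A′ zero j) * minor B j)
        ≈⟨ solve 5 (λ s a c a′ d → s :* ((a :+ c :* a′) :* d) := s :* (a :* d) :+ c :* (s :* (a′ :* d))) refl _ _ _ _ _ ⟩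
      sgn R (toℕ j) * (A zero j * minor B j) + c * (sgn R (toℕ j) * (A′ zero j * minor B j))
        ≈⟨ +-cong (*-congˡ (*-congˡ (det-cong n (λ i l → offA (suc i) _ (Finₚ.punchInᵢ≢i j l)))))
                  (*-congˡ (*-congˡ (*-congˡ (det-cong n (λ i l → offA′ (suc i) _ (Finₚ.punchInᵢ≢i j l)))))) ⟩
      _ ∎
    ... | no j≢p = begin
      sgn R (toℕ j) * (B zero j * minor B j)
        ≈⟨ *-congˡ (*-congˡ (det-linear n p′ _ _ _ c
             (λ i x x≢ → offA (suc i) _ (off x≢))
             (λ i x x≢ → offA′ (suc i) _ (off x≢))
             (λ i → ≡.subst (λ y → B (suc i) y ≈ A (suc i) y + c * A′ (suc i) y) (≡.sym at) (atp (suc i))))) ⟩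
      sgn R (toℕ j) * (B zero j * (minor A j + c * minor A′ j))
        ≈⟨ solve 5 (λ s b c d d′ → s :* (b :* (d :+ c :* d′)) := s :* (b :* d) :+ c :* (s :* (b :* d′))) refl _ _ _ _ _ ⟩
      sgn R (toℕ j) * (B zero j * minor A j) + c * (sgn R (toℕ j) * (B zero j * minor A′ j))
        ≈⟨ +-cong (*-congˡ (*-congʳ (offA zero j j≢p))) (*-congˡ (*-congˡ (*-congʳ (offA′ zero j j≢p)))) ⟩
      _ ∎
      where
      p′ : Fin n
      p′ = punchOut j≢p
      at : punchIn j p′ ≡ p
      at = Finₚ.punchIn-punchOut j≢p
      off : ∀ {x} → x ≢ p′ → punchIn j x ≢ p
      off x≢ eq = x≢ (Finₚ.punchIn-injective j _ _ (≡.trans eq (≡.sym at)))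

  punchIn-adjacent : ∀ {n} (i l : Fin n) →
    (punchIn (inject₁ i) l ≡ punchIn (suc i) l) ⊎
    (punchIn (inject₁ i) l ≡ suc i × punchIn (suc i) l ≡ inject₁ i)
  punchIn-adjacent zero zero = inj₂ (≡.refl , ≡.refl)
  punchIn-adjacent zero (suc l) = inj₁ ≡.refl
  punchIn-adjacent (suc i) zero = inj₁ ≡.refl
  punchIn-adjacent (suc i) (suc l) with punchIn-adjacent i l
  ... | inj₁ eq = inj₁ (≡.cong suc eq)
  ... | inj₂ (eq , eq′) = inj₂ (≡.cong suc eq , ≡.cong suc eq′)

  punchIn-avoiding : ∀ {n} (i : Fin (suc n)) (j : Fin (suc (suc n))) → j ≢ inject₁ i → j ≢ suc i →
    ∃[ i′ ] (punchIn j (inject₁ {n} i′) ≡ inject₁ i × punchIn j (suc i′) ≡ suc i)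
  punchIn-avoiding zero zero j≢ _ = contradiction ≡.refl j≢
  punchIn-avoiding zero (suc zero) _ j≢ = contradiction ≡.refl j≢
  punchIn-avoiding {suc n} zero (suc (suc j)) _ _ = zero , ≡.refl , ≡.refl
  punchIn-avoiding (suc i) zero _ _ = i , ≡.refl , ≡.refl
  punchIn-avoiding {suc n} (suc i) (suc j) j≢ j≢′
    with punchIn-avoiding i j (j≢ ∘ ≡.cong suc) (j≢′ ∘ ≡.cong suc)
  ... | i′ , eq , eq′ = suc i′ , ≡.cong suc eq , ≡.cong suc eq′

  -- Deleting one or the other of the two equal columns gives equal minors with opposite signs.
  -- Deleting any other column leaves the two still consecutive, so those minors vanish by
  -- induction.
  det-consecutive-equal : ∀ n (i : Fin n) (A : Matrix (suc n) (suc n)) →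
    (∀ r → A r (inject₁ i) ≈ A r (suc i)) → det R (suc n) A ≈ 0#
  det-consecutive-equal (suc n) i A eq = sum-adjacent-cancel (suc n) i _ cancel vanish
    where
    same-minor : ∀ r l → A (suc r) (punchIn (inject₁ i) l) ≈ A (suc r) (punchIn (suc i) l)
    same-minor r l with punchIn-adjacent i l
    ... | inj₁ e = reflexive (≡.cong (A (suc r)) e)
    ... | inj₂ (e , e′) = trans (reflexive (≡.cong (A (suc r)) e))
      (trans (sym (eq (suc r))) (reflexive (≡.cong (A (suc r)) (≡.sym e′))))
    cancel : _
    cancel = begin
      sgn R (toℕ (inject₁ i)) * _ + - sgn R (toℕ i) * _
        ≈⟨ +-congʳ (*-cong (reflexive (≡.cong (sgn R) (Finₚ.toℕ-inject₁ i)))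
                           (*-cong (eq zero) (det-cong (suc n) same-minor))) ⟩
      sgn R (toℕ i) * _ + - sgn R (toℕ i) * _
        ≈⟨ solve 2 (λ s x → s :* x :+ (:- s) :* x := :0) refl _ _ ⟩
      0# ∎
    vanish : ∀ j → j ≢ inject₁ i → j ≢ suc i → _ ≈ 0#
    vanish j j≢ j≢′ with punchIn-avoiding i j j≢ j≢′
    ... | i′ , e , e′ = begin
      sgn R (toℕ j) * (A zero j * det R (suc n) (λ r l → A (suc r) (punchIn j l)))
        ≈⟨ *-congˡ (*-congˡ (det-consecutive-equal n i′ (λ r l → A (suc r) (punchIn j l)) columns)) ⟩
      sgn R (toℕ j) * (A zero j * 0#)
        ≈⟨ solve 2 (λ s a → s :* (a :* :0) := :0) refl _ _ ⟩
      0# ∎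
      where
      columns : ∀ r → A (suc r) (punchIn j (inject₁ i′)) ≈ A (suc r) (punchIn j (suc i′))
      columns r = trans (reflexive (≡.cong (A (suc r)) e))
        (trans (eq (suc r)) (reflexive (≡.cong (A (suc r)) (≡.sym e′))))

  det-successor-equal : ∀ n (s t : Fin n) → toℕ t ≡ suc (toℕ s) → (A : Matrix n n) →
    (∀ r → A r s ≈ A r t) → det R n A ≈ 0#
  det-successor-equal (suc n) s (suc t) eq A cols = det-consecutive-equal n t A
    (λ r → trans (reflexive (≡.cong (A r) (≡.sym s≡))) (cols r))
    where
    s≡ : s ≡ inject₁ t
    s≡ = Finₚ.toℕ-injective (≡.trans (≡.sym (ℕₚ.suc-injective eq)) (≡.sym (Finₚ.toℕ-inject₁ t)))

  det-adjacent-equal : ∀ n (s t : Fin n) → Adjacent s t → (A : Matrix n n) →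
    (∀ r → A r s ≈ A r t) → det R n A ≈ 0#
  det-adjacent-equal n s t (inj₁ eq) A cols = det-successor-equal n s t eq A cols
  det-adjacent-equal n s t (inj₂ eq) A cols = det-successor-equal n t s eq A (sym ∘ cols)

  increasing-injective : ∀ {r k} {σ : Fin r → Fin k} → StrictlyIncreasing R σ →
    ∀ {x y} → σ x ≡ σ y → x ≡ y
  increasing-injective inc {x} {y} eq with Finₚ.<-cmp x y
  ... | tri< x<y _ _ = contradiction (≡.cong toℕ eq) (ℕₚ.<⇒≢ (inc x y x<y))
  ... | tri≈ _ x≡y _ = x≡y
  ... | tri> _ _ y<x = contradiction (≡.cong toℕ (≡.sym eq)) (ℕₚ.<⇒≢ (inc y x y<x))

  -- If `t` lay beyond `s + 1`, the index `x = s + 1` would have a value strictly between two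
  -- consecutive numbers; if `t` were at most `s`, its value could not exceed that of `s`.
  increasing-successor : ∀ {r k} {σ : Fin r → Fin k} → StrictlyIncreasing R σ →
    ∀ {s t} → toℕ (σ t) ≡ suc (toℕ (σ s)) → toℕ t ≡ suc (toℕ s)
  increasing-successor {σ = σ} inc {s} {t} eq with ℕₚ.<-cmp (toℕ t) (suc (toℕ s))
  ... | tri≈ _ e _ = e
  ... | tri< t≤s _ _ with t Finₚ.≟ s
  ...   | yes ≡.refl = contradiction (≡.sym eq) ℕₚ.1+n≢n
  ...   | no t≢s = contradiction
    (ℕₚ.<-trans (ℕₚ.n<1+n _) (≡.subst (ℕ._< _) eq (inc t s (ℕₚ.≤∧≢⇒< (ℕ.s≤s⁻¹ t≤s) (t≢s ∘ Finₚ.toℕ-injective)))))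
    (ℕₚ.<-irrefl ≡.refl)
  increasing-successor {σ = σ} inc {s} {t} eq | tri> _ _ s+1<t =
    contradiction (ℕₚ.<-≤-trans (inc x t x<t) (≡.subst (_≤ toℕ (σ x)) (≡.sym eq) (inc s x s<x))) (ℕₚ.<-irrefl ≡.refl)
    where
    bound = ℕₚ.<-trans s+1<t (Finₚ.toℕ<n t)
    x = fromℕ< bound
    x≡ : toℕ x ≡ suc (toℕ s)
    x≡ = Finₚ.toℕ-fromℕ< bound
    s<x : s Fin.< x
    s<x = ≡.subst (toℕ s ℕ.<_) (≡.sym x≡) ℕₚ.≤-refl
    x<t : x Fin.< t
    x<t = ≡.subst (ℕ._< toℕ t) (≡.sym x≡) s+1<t

  increasing-adjacent : ∀ {r k} {σ : Fin r → Fin k} → StrictlyIncreasing R σ →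
    ∀ {s t} → Adjacent (σ s) (σ t) → Adjacent s t
  increasing-adjacent inc (inj₁ eq) = inj₁ (increasing-successor inc eq)
  increasing-adjacent inc (inj₂ eq) = inj₂ (increasing-successor inc eq)

  increasing-updateAt : ∀ {r k} {σ : Fin r → Fin k} → StrictlyIncreasing R σ →
    ∀ s {q} → Adjacent (σ s) q → (∀ t → σ t ≢ q) → StrictlyIncreasing R (updateAt σ s (const q))
  increasing-updateAt {σ = σ} inc s {q} adj q∉ x y x<y with x Finₚ.≟ s | y Finₚ.≟ s
  ... | yes ≡.refl | yes ≡.refl = contradiction x<y (ℕₚ.<-irrefl ≡.refl)
  ... | yes ≡.refl | no y≢s = ≡.subst₂ Fin._<_
    (≡.sym (Vectorₚ.updateAt-updates x σ)) (≡.sym (Vectorₚ.updateAt-minimal y s σ y≢s))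
    (adjacent-< adj (q∉ y) (inc x y x<y))
  ... | no x≢s | yes ≡.refl = ≡.subst₂ Fin._<_
    (≡.sym (Vectorₚ.updateAt-minimal x s σ x≢s)) (≡.sym (Vectorₚ.updateAt-updates y σ))
    (adjacent-> adj (q∉ x) (inc x y x<y))
  ... | no x≢s | no y≢s = ≡.subst₂ Fin._<_
    (≡.sym (Vectorₚ.updateAt-minimal x s σ x≢s)) (≡.sym (Vectorₚ.updateAt-minimal y s σ y≢s))
    (inc x y x<y)

  -- Spelled exactly as in `InG`, so that `InG R A` unfolds to membership of `1#` in the span of
  -- `Minor A`.
  Minor : ∀ {r k} → Matrix r k → Subset R
  Minor {r} A y = Lift c (∃[ σ ] (StrictlyIncreasing R σ × y ≈ det R r (λ i j → A i (σ j))))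

  -- Adjacency of p and q ensures that replacing p by q in an increasing
  -- sequence of columns leaves it increasing or repeats a neighbouring column, so
  -- no permutation of columns is ever needed.
  minor-column-operation : ∀ {r k} (A B : Matrix r k) {p q : Fin k} → Adjacent p q → ∀ c →
    (∀ i x → x ≢ p → B i x ≈ A i x) → (∀ i → B i p ≈ A i p + c * A i q) →
    _⊆_ R (Minor B) (⟨_⟩ R (Minor A))
  minor-column-operation {r} {k} A B {p} {q} adj c off at y (lift (σ , inc , y≈)) with Finₚ.any? (λ s → σ s Finₚ.≟ p)
  ... | no p∉ = span-generator (lift (σ , inc , trans y≈ (det-cong r (λ i j → off i (σ j) (λ e → p∉ (j , e))))))
  ... | yes (s , ≡.refl) = resp idS (sym (trans y≈ expand)) (+∈ idS (span-generator (lift (σ , inc , refl))) (*∈ idS c replaced∈))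
    where
    idS = span-ideal (Minor A)
    σ′ : Fin r → Fin k
    σ′ = updateAt σ s (const q)
    σ′-at : σ′ s ≡ q
    σ′-at = Vectorₚ.updateAt-updates s σ
    σ′-off : ∀ {x} → x ≢ s → σ′ x ≡ σ x
    σ′-off {x} x≢s = Vectorₚ.updateAt-minimal x s σ x≢s
    column : ∀ i {x y} → x ≡ y → A i x ≈ A i y
    column i e = reflexive (≡.cong (A i) e)
    off-s : ∀ i x → x ≢ s → B i (σ x) ≈ A i (σ x)
    off-s i x x≢s = off i (σ x) (x≢s ∘ increasing-injective inc)
    expand : det R r (λ i j → B i (σ j)) ≈ det R r (λ i j → A i (σ j)) + c * det R r (λ i j → A i (σ′ j))
    expand = det-linear r s _ _ _ c off-s
      (λ i x x≢s → trans (off-s i x x≢s) (column i (≡.sym (σ′-off x≢s))))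
      (λ i → trans (at i) (+-congˡ (*-congˡ (column i (≡.sym σ′-at)))))
    replaced∈ : ⟨_⟩ R (Minor A) (det R r (λ i j → A i (σ′ j)))
    replaced∈ with Finₚ.any? (λ t → σ t Finₚ.≟ q)
    ... | no q∉ = span-generator (lift (σ′ , increasing-updateAt inc s adj (λ t e → q∉ (t , e)) , refl))
    ... | yes (t , ≡.refl) = resp idS (sym (det-adjacent-equal r s t (increasing-adjacent inc adj) _
        (λ i → column i (≡.trans σ′-at (≡.sym (σ′-off t≢s))))))
        (zero∈ idS)
      where
      t≢s : t ≢ s
      t≢s t≡s = adjacent-≢ adj (≡.cong σ t≡s)

  -- Kronecker's delta, by recursion on numbers instead of a decision: it then computes when a row
  -- is shifted by one column.
  δ : ℕ → ℕ → Carrier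
  δ zero    zero    = 1#
  δ zero    (suc _) = 0#
  δ (suc _) zero    = 0#
  δ (suc m) (suc n) = δ m n

  δ-≡ : ∀ n → δ n n ≈ 1#
  δ-≡ zero = refl
  δ-≡ (suc n) = δ-≡ n

  δ-≢ : ∀ {m n} → m ≢ n → δ m n ≈ 0#
  δ-≢ {zero} {zero} m≢n = contradiction ≡.refl m≢n
  δ-≢ {zero} {suc n} m≢n = refl
  δ-≢ {suc m} {zero} m≢n = refl
  δ-≢ {suc m} {suc n} m≢n = δ-≢ (m≢n ∘ ≡.cong suc)

  det-identity : ∀ n → det R n (λ i j → δ (toℕ j) (toℕ i)) ≈ 1#
  det-identity zero = refl
  det-identity (suc n) = begin
    1# * (1# * det R n (λ i j → δ (toℕ j) (toℕ i))) + sumFin R n _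
      ≈⟨ +-cong (*-congˡ (*-congˡ (det-identity n)))
                (sum-zero n (λ j → solve 2 (λ s d → s :* (:0 :* d) := :0) refl _ _)) ⟩
    1# * (1# * 1#) + 0#
      ≈⟨ solve 0 (:1 :* (:1 :* :1) :+ :0 := :1) refl ⟩
    1# ∎

  unitRows : ∀ {r k} → r ≤ k → Matrix r k
  unitRows r≤k l i = δ (toℕ i) (toℕ (inject≤ l r≤k))

  -- The first `r` columns form the identity matrix, so one minor is already 1.
  unitRows-InG : ∀ {r k} (r≤k : r ≤ k) → InG R (unitRows r≤k)
  unitRows-InG {r} r≤k = span-generator (lift ((λ j → inject≤ j r≤k) , increasing , sym (trans
    (det-cong r (λ i j → reflexive (≡.cong₂ δ (Finₚ.toℕ-inject≤ j r≤k) (Finₚ.toℕ-inject≤ i r≤k))))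
    (det-identity r))))
    where
    increasing : StrictlyIncreasing R (λ j → inject≤ j r≤k)
    increasing i j = ≡.subst₂ ℕ._<_ (≡.sym (Finₚ.toℕ-inject≤ i r≤k)) (≡.sym (Finₚ.toℕ-inject≤ j r≤k))

-- Lists of column operations and the reduction of unital rows modulo an ideal.

module ColumnOperations {c ℓ : Level} (R : CommutativeRing c ℓ) where
  open CommutativeRing R hiding (zero)
  open CommutativeRingSolver R
  open Ideals R
  open Minors R
  open IsIdeal

  Row : ℕ → Set c
  Row k = Fin k → Carrier

  record ColumnOp (k : ℕ) : Set c where
    field
      target source : Fin k
      adjacent      : Adjacent target source
      coefficient   : Carrier

  open ColumnOp

  -- The factor `δ` replaces a case distinction on `i`: each entry stays a ring expression, so
  -- inverses, scalars and congruences are handled uniformly in `i`.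
  apply : ∀ {k} → ColumnOp k → Row k → Row k
  apply o a i = a i + δ (toℕ i) (toℕ (target o)) * (coefficient o * a (source o))

  run : ∀ {k} → List (ColumnOp k) → Row k → Row k
  run []       a = a
  run (o ∷ os) a = run os (apply o a)

  run-++ : ∀ {k} (os os′ : List (ColumnOp k)) a → run (os ++ os′) a ≡ run os′ (run os a)
  run-++ []       os′ a = ≡.refl
  run-++ (o ∷ os) os′ a = run-++ os os′ (apply o a)

  apply-target : ∀ {k} (o : ColumnOp k) a → apply o a (target o) ≈ a (target o) + coefficient o * a (source o)
  apply-target o a = +-congˡ (trans (*-congʳ (δ-≡ (toℕ (target o)))) (*-identityˡ _))

  apply-off : ∀ {k} (o : ColumnOp k) a {i} → i ≢ target o → apply o a i ≈ a i
  apply-off o a i≢ = trans (+-congˡ (trans (*-congʳ (δ-≢ (i≢ ∘ Finₚ.toℕ-injective))) (zeroˡ _))) (+-identityʳ _)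

  apply-source : ∀ {k} (o : ColumnOp k) a → apply o a (source o) ≈ a (source o)
  apply-source o a = apply-off o a (adjacent-≢ (adjacent o))

  -- The negated coefficient recovers `A` from its image, so the minors of `A` lie in the ideal of
  -- the minors of the image. This inclusion is the direction that carries 1 over.
  InG-apply : ∀ {r k} (o : ColumnOp k) (A : Matrix r k) → InG R A → InG R (λ l → apply o (A l))
  InG-apply o A = span-least (span-ideal (Minor (λ l → apply o (A l))))
    (minor-column-operation (λ l → apply o (A l)) A (adjacent o) (- coefficient o)
      (λ l x x≢ → sym (apply-off o (A l) x≢))
      (λ l → sym (trans (+-cong (apply-target o (A l)) (*-congˡ (apply-source o (A l))))
        (solve 3 (λ a c b → (a :+ c :* b) :+ (:- c) :* b := a) refl _ _ _)))) 1#

  InG-run : ∀ {r k} (os : List (ColumnOp k)) (A : Matrix r k) → InG R A → InG R (λ l → run os (A l))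
  InG-run []       A g = g
  InG-run (o ∷ os) A g = InG-run os _ (InG-apply o A g)

  inverse : ∀ {k} → ColumnOp k → ColumnOp k
  inverse o = record o { coefficient = - coefficient o }

  apply-inverse : ∀ {k} (o : ColumnOp k) a i → apply (inverse o) (apply o a) i ≈ a i
  apply-inverse o a i = trans (+-congˡ (*-congˡ (*-congˡ (apply-source o a))))
    (solve 4 (λ a d c b → (a :+ d :* (c :* b)) :+ d :* ((:- c) :* b) := a) refl _ _ _ _)

  undo : ∀ {k} → List (ColumnOp k) → List (ColumnOp k)
  undo []       = []
  undo (o ∷ os) = undo os ++ inverse o ∷ []

  scale : ∀ {k} → Carrier → ColumnOp k → ColumnOp k
  scale ε o = record o { coefficient = coefficient o * ε }

  shift : ∀ {k} → ColumnOp k → ColumnOp (suc k)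
  shift o = record
    { target      = suc (target o)
    ; source      = suc (source o)
    ; adjacent    = Sum.map (≡.cong suc) (≡.cong suc) (adjacent o)
    ; coefficient = coefficient o
    }

  total : ∀ {k m} → (Fin m → List (ColumnOp k)) → List (ColumnOp k)
  total {m = zero}  f = []
  total {m = suc m} f = f zero ++ total (f ∘ suc)

  module Congruence (I : Subset R) (idI : IsIdeal R I) where

    infix 4 _≋_ _≋ᵣ_ _∼_

    _≋_ : Carrier → Carrier → Set (c ⊔ ℓ)
    x ≋ y = I (x + - y)

    ≈⇒≋ : ∀ {x y} → x ≈ y → x ≋ y
    ≈⇒≋ {x} {y} x≈y = resp idI (trans (sym (-‿inverseʳ y)) (+-congʳ (sym x≈y))) (zero∈ idI)

    ≋-refl : ∀ {x} → x ≋ x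
    ≋-refl = ≈⇒≋ refl

    ≋-sym : ∀ {x y} → x ≋ y → y ≋ x
    ≋-sym {x} {y} p = resp idI (solve 2 (λ x y → :- (x :- y) := y :- x) refl x y) (neg∈ idI p)

    ≋-trans : ∀ {x y z} → x ≋ y → y ≋ z → x ≋ z
    ≋-trans {x} {y} {z} p q =
      resp idI (solve 3 (λ x y z → (x :- y) :+ (y :- z) := x :- z) refl x y z) (+∈ idI p q)

    ≋-+ : ∀ {x x′ y y′} → x ≋ x′ → y ≋ y′ → x + y ≋ x′ + y′
    ≋-+ {x} {x′} {y} {y′} p q =
      resp idI (solve 4 (λ x x′ y y′ → (x :- x′) :+ (y :- y′) := (x :+ y) :- (x′ :+ y′)) refl x x′ y y′) (+∈ idI p q)

    ≋-* : ∀ {x x′ y y′} → x ≋ x′ → y ≋ y′ → x * y ≋ x′ * y′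
    ≋-* {x} {x′} {y} {y′} p q =
      resp idI (solve 4 (λ x x′ y y′ → y :* (x :- x′) :+ x′ :* (y :- y′) := x :* y :- x′ :* y′) refl x x′ y y′)
        (+∈ idI (*∈ idI y p) (*∈ idI x′ q))

    ≋-*ˡ : ∀ {x y y′} → y ≋ y′ → x * y ≋ x * y′
    ≋-*ˡ = ≋-* ≋-refl

    _≋ᵣ_ : ∀ {k} → Row k → Row k → Set (c ⊔ ℓ)
    a ≋ᵣ b = ∀ i → a i ≋ b i

    ≡⇒≋ᵣ : ∀ {k} {a b : Row k} → a ≡ b → a ≋ᵣ b
    ≡⇒≋ᵣ ≡.refl i = ≋-refl

    apply-cong : ∀ {k} (o : ColumnOp k) {a b} → a ≋ᵣ b → apply o a ≋ᵣ apply o b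
    apply-cong o a≋b i = ≋-+ (a≋b i) (≋-*ˡ (≋-*ˡ (a≋b (source o))))

    run-cong : ∀ {k} (os : List (ColumnOp k)) {a b} → a ≋ᵣ b → run os a ≋ᵣ run os b
    run-cong []       a≋b = a≋b
    run-cong (o ∷ os) a≋b = run-cong os (apply-cong o a≋b)

    run-undo : ∀ {k} (os : List (ColumnOp k)) a → run (undo os) (run os a) ≋ᵣ a
    run-undo []       a i = ≋-refl
    run-undo (o ∷ os) a i = ≋-trans (≡⇒≋ᵣ (run-++ (undo os) (inverse o ∷ []) _) i)
      (≋-trans (apply-cong (inverse o) (run-undo os (apply o a)) i) (≈⇒≋ (apply-inverse o a i)))

    run-scalar : ∀ {k} (os : List (ColumnOp k)) u a → run os (λ i → u * a i) ≋ᵣ (λ i → u * run os a i)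
    run-scalar []       u a i = ≋-refl
    run-scalar (o ∷ os) u a i = ≋-trans
      (run-cong os (λ j → ≈⇒≋ (solve 5 (λ u a d c b → u :* a :+ d :* (c :* (u :* b)) := u :* (a :+ d :* (c :* b))) refl _ _ _ _ _)) i)
      (run-scalar os u (apply o a) i)

    run-scale-one : ∀ {k ε} → ε ≋ 1# → (os : List (ColumnOp k)) → ∀ a → run (map (scale ε) os) a ≋ᵣ run os a
    run-scale-one ε≋1 []       a i = ≋-refl
    run-scale-one ε≋1 (o ∷ os) a i = ≋-trans
      (run-cong (map (scale _) os) (λ j → ≋-+ ≋-refl (≋-*ˡ (≋-* (≋-trans (≋-*ˡ ε≋1) (≈⇒≋ (*-identityʳ _))) ≋-refl))) i)
      (run-scale-one ε≋1 os (apply o a) i)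

    run-scale-zero : ∀ {k ε} → I ε → (os : List (ColumnOp k)) → ∀ a → run (map (scale ε) os) a ≋ᵣ a
    run-scale-zero ε∈ []       a i = ≋-refl
    run-scale-zero {ε = ε} ε∈ (o ∷ os) a i = ≋-trans
      (run-cong (map (scale ε) os) (λ j → resp idI
        (solve 5 (λ ε a d c b → (d :* c :* b) :* ε := (a :+ d :* ((c :* ε) :* b)) :- a) refl ε _ _ _ _)
        (*∈ idI _ ε∈)) i)
      (run-scale-zero ε∈ os a i)

    run-total-trivial : ∀ {k m} (f : Fin m → List (ColumnOp k)) →
      (∀ x a → run (f x) a ≋ᵣ a) → ∀ a → run (total f) a ≋ᵣ a
    run-total-trivial {m = zero}  f triv a i = ≋-refl
    run-total-trivial {m = suc m} f triv a i = ≋-trans (≡⇒≋ᵣ (run-++ (f zero) (total (f ∘ suc)) a) i)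
      (≋-trans (run-total-trivial (f ∘ suc) (triv ∘ suc) (run (f zero) a) i) (triv zero a i))

    run-total-at : ∀ {k m} (f : Fin m → List (ColumnOp k)) l →
      (∀ x → x ≢ l → ∀ a → run (f x) a ≋ᵣ a) → ∀ a → run (total f) a ≋ᵣ run (f l) a
    run-total-at {m = suc m} f zero triv a i = ≋-trans (≡⇒≋ᵣ (run-++ (f zero) (total (f ∘ suc)) a) i)
      (run-total-trivial (f ∘ suc) (λ x → triv (suc x) (λ ())) (run (f zero) a) i)
    run-total-at {m = suc m} f (suc l) triv a i = ≋-trans (≡⇒≋ᵣ (run-++ (f zero) (total (f ∘ suc)) a) i)
      (≋-trans (run-total-at (f ∘ suc) l (λ x x≢l → triv (suc x) (x≢l ∘ Finₚ.suc-injective)) (run (f zero) a) i)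
        (run-cong (f (suc l)) (triv zero (λ ()) a) i))

    -- The operations have coefficients in `R`; only their outcome is read modulo `I`. A list found
    -- for one ideal can thus be rescaled, run on the whole matrix and read modulo another ideal.
    _∼_ : ∀ {k} → Row k → Row k → Set (c ⊔ ℓ)
    a ∼ b = ∃[ os ] run os a ≋ᵣ b

    ≋ᵣ⇒∼ : ∀ {k} {a b : Row k} → a ≋ᵣ b → a ∼ b
    ≋ᵣ⇒∼ a≋b = [] , a≋b

    ∼-trans : ∀ {k} {a b d : Row k} → a ∼ b → b ∼ d → a ∼ d
    ∼-trans {a = a} (os , p) (os′ , q) = os ++ os′ ,
      λ i → ≋-trans (≡⇒≋ᵣ (run-++ os os′ a) i) (≋-trans (run-cong os′ p i) (q i))

    ∼-sym : ∀ {k} {a b : Row k} → a ∼ b → b ∼ a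
    ∼-sym {a = a} (os , p) = undo os , λ i → ≋-trans (≋-sym (run-cong (undo os) p i)) (run-undo os a i)

    ∼-apply : ∀ {k} (o : ColumnOp k) {a b : Row k} → apply o a ≋ᵣ b → a ∼ b
    ∼-apply o p = o ∷ [] , p

    ∼-∷ : ∀ {k} {a : Row (suc k)} {b : Row k} → (a ∘ suc) ∼ b → a ∼ (a zero Vector.∷ b)
    ∼-∷ {k} {a} {b} (os , p) = map shift os , go os a p
      where
      go : ∀ os a → run os (a ∘ suc) ≋ᵣ b → run (map shift os) a ≋ᵣ (a zero Vector.∷ b)
      go [] a p zero = ≋-refl
      go [] a p (suc i) = p i
      go (o ∷ os) a p zero = ≋-trans (go os (apply (shift o) a) p zero)
        (≈⇒≋ (solve 2 (λ a x → a :+ :0 :* x := a) refl _ _))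
      go (o ∷ os) a p (suc i) = go os (apply (shift o) a) p (suc i)

    addSecondToFirst : ∀ {k} → Carrier → ColumnOp (suc (suc k))
    addSecondToFirst x = record { target = zero ; source = suc zero ; adjacent = inj₁ ≡.refl ; coefficient = x }

    addFirstToSecond : ∀ {k} → Carrier → ColumnOp (suc (suc k))
    addFirstToSecond x = record { target = suc zero ; source = zero ; adjacent = inj₂ ≡.refl ; coefficient = x }

    ∼-addSecondToFirst : ∀ {k} x (a : Row (suc (suc k))) →
      a ∼ ((a zero + x * a (suc zero)) Vector.∷ (a ∘ suc))
    ∼-addSecondToFirst x a = ∼-apply (addSecondToFirst x) λ
      { zero    → ≈⇒≋ (+-congˡ (*-identityˡ _))
      ; (suc i) → ≈⇒≋ (solve 2 (λ a x → a :+ :0 :* x := a) refl _ _) }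

    ∼-addFirstToSecond : ∀ {k} x (a : Row (suc (suc k))) →
      a ∼ (a zero Vector.∷ (a (suc zero) + x * a zero) Vector.∷ (λ i → a (suc (suc i))))
    ∼-addFirstToSecond x a = ∼-apply (addFirstToSecond x) λ
      { zero          → ≈⇒≋ (solve 2 (λ a x → a :+ :0 :* x := a) refl _ _)
      ; (suc zero)    → ≈⇒≋ (+-congˡ (*-identityˡ _))
      ; (suc (suc i)) → ≈⇒≋ (solve 2 (λ a x → a :+ :0 :* x := a) refl _ _) }

    ∷-cong : ∀ {k x y} {a b : Row k} → x ≋ y → a ≋ᵣ b → (x Vector.∷ a) ≋ᵣ (y Vector.∷ b)
    ∷-cong x≋y a≋b zero    = x≋y
    ∷-cong x≋y a≋b (suc i) = a≋b i

    -- A unit head makes the second entry 1; then either the second entry clears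
    -- the head and one recurses, or the tail is cleared and the head clears it.
    unit-head-∼ : ∀ n (l : Fin (suc n)) (a : Row (suc n)) → InvertibleMod I (a zero) →
      ∃[ u ] a ∼ (λ i → u * δ (toℕ i) (toℕ l))
    unit-head-∼ zero zero a _ = a zero , ≋ᵣ⇒∼ λ { zero → ≈⇒≋ (sym (*-identityʳ _)) }
    unit-head-∼ (suc n) l a (y , inv) = finish l
      where
      rest : Row n
      rest i = a (suc (suc i))
      one-invertible : InvertibleMod I 1#
      one-invertible = 1# , ≈⇒≋ (sym (*-identityʳ 1#))
      second-one : a ∼ (a zero Vector.∷ 1# Vector.∷ rest)
      -- Modulo `I` the product `y * a zero` is 1, so this coefficient adds `1 - a (suc zero)`. The
      -- resulting 1 is also the invertible head that the recursion on the tail requires.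
      second-one = ∼-trans (∼-addFirstToSecond (y * (1# + - a (suc zero))) a)
        (≋ᵣ⇒∼ (∷-cong ≋-refl (∷-cong
          (≋-trans (≈⇒≋ (solve 3 (λ a0 a1 y → a1 :+ y :* (:1 :- a1) :* a0 := a1 :+ (:1 :- a1) :* (a0 :* y)) refl _ _ y))
          (≋-trans (≋-+ ≋-refl (≋-*ˡ (≋-sym inv)))
            (≈⇒≋ (solve 1 (λ a1 → a1 :+ (:1 :- a1) :* :1 := :1) refl _))))
          (λ i → ≋-refl))))
      finish : ∀ l → ∃[ u ] a ∼ (λ i → u * δ (toℕ i) (toℕ l))
      -- The tail becomes `u` times its first unit row. Since `a zero * y` is 1 modulo `I`, adding
      -- `- (u * y)` times the head removes that `u`.
      finish zero with unit-head-∼ n zero (1# Vector.∷ rest) one-invertible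
      ... | u , p = a zero , ∼-trans second-one (∼-trans (∼-∷ p) (∼-trans (∼-addFirstToSecond (- (u * y)) _) (≋ᵣ⇒∼ λ
        { zero → ≈⇒≋ (sym (*-identityʳ _))
        ; (suc zero) → ≋-trans (≈⇒≋ (solve 3 (λ u y a → u :* :1 :+ (:- (u :* y)) :* a := u :* (:1 :- a :* y)) refl u y _))
            (≋-trans (≋-*ˡ (≋-trans (≋-+ ≋-refl (resp idI (solve 2 (λ a y → :1 :- a :* y := (:- (a :* y)) :- (:- :1)) refl _ _) inv))
              (≈⇒≋ (-‿inverseʳ 1#)))) (≈⇒≋ (solve 2 (λ u a → u :* :0 := a :* :0) refl u _)))
        ; (suc (suc i)) → ≈⇒≋ (solve 2 (λ u a → u :* :0 := a :* :0) refl u _) })))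
      finish (suc l) with unit-head-∼ n l (1# Vector.∷ rest) one-invertible
      ... | u , p = u , ∼-trans second-one (∼-trans (∼-addSecondToFirst (- a zero) _) (∼-trans (∼-∷ p) (≋ᵣ⇒∼ λ
        { zero    → ≈⇒≋ (solve 2 (λ a u → a :+ (:- a) :* :1 := u :* :0) refl _ u)
        ; (suc i) → ≋-refl })))

    -- Stable range is folded from the last entry to the first: the head of the treated tail already
    -- stands for all entries of the tail, so adding one multiple of it to `a zero` is enough.
    gather-head : ∀ {Ms} → All (IsMaximal R) Ms → ∀ n (a : Row (suc n)) →
      ∃[ b ] (a ∼ b × All (λ M → M (b zero) → ∀ i → M (a i)) Ms)
    gather-head maxMs zero a = a , ≋ᵣ⇒∼ (λ i → ≋-refl) , All.map (λ _ → λ { a∈ zero → a∈ }) maxMs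
    gather-head maxMs (suc n) a with gather-head maxMs n (a ∘ suc)
    ... | b , a∼b , good with stable-range maxMs (a zero) (b zero)
    ...   | t , range = ((a zero + t * b zero) Vector.∷ b) , ∼-trans (∼-∷ a∼b) (∼-addSecondToFirst t _) ,
      All.zipWith (λ (g , h) x∈ → λ { zero → proj₁ (h x∈) ; (suc i) → g (proj₂ (h x∈)) i }) (good , range)

    -- The gathered head lies in no maximal factor of `I`, since such a factor would contain every
    -- `v i` and hence 1. It is therefore invertible modulo each factor, modulo their product, and
    -- modulo `I`.
    unital-∼ : InM R I → ∀ n (l : Fin (suc n)) (v : Row (suc n)) → Unital R v →
      ∃[ u ] v ∼ (λ i → u * δ (toℕ i) (toℕ l))
    unital-∼ (Ms , maxMs , I≐) n l v uni with gather-head maxMs n v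
    ... | b , v∼b , good with invertible-prodList {b zero} Ms (All.zipWith unit (maxMs , good))
      where
      unit : ∀ {M} → IsMaximal R M × (M (b zero) → ∀ i → M (v i)) → InvertibleMod M (b zero)
      unit {M} (maxM , g) with maximal-dec maxM (b zero)
      ... | inj₂ inv = inv
      ... | inj₁ b∈  = contradiction
        (span-least idM (λ y (lift (i , y≈)) → resp idM (sym y≈) (g b∈ i)) 1# uni) (IsMaximal.proper maxM)
        where idM = IsMaximal.ideal maxM
    ...   | y , inv with unit-head-∼ n l b (y , proj₂ I≐ _ inv)
    ...     | u , b∼ = u , ∼-trans v∼b b∼

    -- Modulo `I` both cross products equal `u * a i * a j`.
    proportional-PFRel : ∀ {k} u {a v : Row k} → (λ i → u * a i) ≋ᵣ v → PFRel R I a v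
    proportional-PFRel u {a} {v} ua≋v i j _ = ≋-trans (≋-*ˡ (≋-sym (ua≋v j)))
      (≋-trans (≈⇒≋ (solve 3 (λ u x y → x :* (u :* y) := y :* (u :* x)) refl u (a i) (a j))) (≋-*ˡ (ua≋v i)))

-- Surjectivity: the operation lists of all rows run on one matrix.

mainTheorem13 : ∀ {c ℓ : Level} (R : CommutativeRing c ℓ)
    → DedekindType R
    → InfinitelyManyMaximal R
    → (r k : ℕ) → 2 ≤ k → r ≤ k
    → (I : Fin r → Subset R)
    → (∀ l → InM R (I l))
    → (∀ l l′ → l ≢ l′ → Comaximal R (I l) (I l′))
    → (v : Fin r → Fin k → CommutativeRing.Carrier R)
    → (∀ l → Unital R (v l))
    → ∃[ A ] (InG R A × (∀ l → PFRel R (I l) (A l) (v l)))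
mainTheorem13 {c} {ℓ} R _ _ r (suc k) _ r≤k I I∈M comaximal v unital =
  A , InG-run ops (unitRows r≤k) (unitRows-InG r≤k) , λ l → row l
  where
  open CommutativeRing R hiding (zero)
  open Ideals R
  open Minors R
  open ColumnOperations R

  idI : ∀ l → IsIdeal R (I l)
  idI l = ideal-resp-≐ (proj₂ (proj₂ (I∈M l))) (prodList-ideal (proj₁ (I∈M l)))

  module I l = Congruence (I l) (idI l)

  reduced : ∀ l → ∃[ u ] (I._∼_ l (v l) (λ i → u * unitRows r≤k l i))
  reduced l = I.unital-∼ l (I∈M l) k (inject≤ l r≤k) (v l) (unital l)

  restored : ∀ l → I._∼_ l (λ i → proj₁ (reduced l) * unitRows r≤k l i) (v l)
  restored l = I.∼-sym l (proj₂ (reduced l))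

  idempotent : ∀ l → ∃[ ε ] (I l (ε + - 1#) × (∀ x → l ≡ x ⊎ I x ε))
  idempotent l = crt-idempotent (idI l) I idI (l ≡_) separated
    where
    separated : ∀ x → l ≡ x ⊎ Comaximal R (I l) (I x)
    separated x with l Finₚ.≟ x
    ... | yes l≡x = inj₁ l≡x
    ... | no  l≢x = inj₂ (comaximal l x l≢x)

  rowOps : Fin r → List (ColumnOp (suc k))
  rowOps l = map (scale (proj₁ (idempotent l))) (proj₁ (restored l))

  ops : List (ColumnOp (suc k))
  ops = total rowOps

  A : Matrix r (suc k)
  A l = run ops (unitRows r≤k l)

  row : ∀ l → PFRel R (I l) (A l) (v l)
  row l = proportional-PFRel u λ i →
    -- The list `os` restores `v l` from `u` times the unit row, whereas `A l` starts at the unit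
    -- row itself; linearity of the operations moves `u` inside.
    ≋-trans (≋-*ˡ (≋-trans (run-total-at rowOps l others _ i) (run-scale-one ε≋1 os _ i)))
    (≋-trans (≋-sym (run-scalar os u _ i)) (proj₂ (restored l) i))
    where
    open Congruence (I l) (idI l)
    u = proj₁ (reduced l)
    os = proj₁ (restored l)
    ε≋1 = proj₁ (proj₂ (idempotent l))
    others : ∀ x → x ≢ l → ∀ a → run (rowOps x) a ≋ᵣ a
    -- The list of row `x` carries the `ε` built for `x`, and it is this element that lies in `I l`.
    others x x≢l with proj₂ (proj₂ (idempotent x)) l
    ... | inj₁ x≡l = contradiction x≡l x≢l
    ... | inj₂ ε∈  = run-scale-zero ε∈ (proj₁ (restored x))
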